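{- For all $n,k \in \mathbb{Z}^+$ with $k \leq \binom{n}{2}$, there exists a universal cycle for $\mathcal{W}_k^-(n)$.
   Context: $\mathcal{W}(n)$ denotes the set of weak orders on $[n]$ (transitive and complete relations), represented as words: $\mathcal{W}(n)$ is the set of all words $w_1w_2\ldots w_n$ of length $n$ over the nonnegative integers such that $\{w_1,\dots,w_n\} = \{0,1,\dots,h\}$ for some $h$ with $0 \le h \le n-1$ (here $w_j$ is the height of element $j$ in the weak order). The weight of $w = w_1\ldots w_n$ is $\sum_{i=1}^n w_i$, and $\mathcal{W}_k(n)$ is the set of $w \in \mathcal{W}(n)$ of weight $k$. The prefix of $w = w_1\ldots w_n$ is $w^- = w_1w_2\ldots w_{n-1}$, and $\mathcal{W}_k^-(n) = \{w^- \mid w \in \mathcal{W}_k(n)\}$, a set of strings of length $n-1$. Let $\mathcal{C}$ be a set of $N$ strings, each of length $m$. A universal cycle (ucycle) for $\mathcal{C}$ is a word $a_0a_1\ldots a_{N-1}$ such that each $c \in \mathcal{C}$ appears exactly once as a subword $a_{i+1}a_{i+2}\ldots a_{i+m}$ (one value of $i$ modulo $N$), where subscripts are taken modulo $N$. (In particular every such subword is a string in $\mathcal{C}$.) -}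

module Defs where

open import Data.Fin using (Fin; toℕ)
open import Data.Fin.Properties using (nonZeroIndex)
open import Data.Nat using (ℕ; suc; pred; _+_; _<_; _≤_)
open import Data.Nat.DivMod using (_mod_)
open import Data.Product using (_×_; ∃-syntax; ∃!)
open import Data.Vec using (Vec; []; _∷_; init; lookup; sum; tabulate)
open import Data.Vec.Membership.Propositional using (_∈_)
open import Data.Vec.Relation.Unary.Unique.Propositional using (Unique)
open import Function using (_⇔_)
open import Level using (0ℓ)
open import Relation.Binary.PropositionalEquality using (_≡_)
open import Relation.Unary using (Pred)

Word : ℕ → Set
Word n = Vec ℕ n

-- The letters occurring in w form the set {0, 1, …, h}, where 0 ≤ h ≤ n − 1.
IsWeakOrder : ∀ {n} → Pred (Word n) 0ℓ
IsWeakOrder {n} w = ∃[ h ] (h < n × (∀ v → v ∈ w ⇔ v ≤ h))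

weight : ∀ {n} → Word n → ℕ
weight = sum

𝒲 : (k n : ℕ) → Pred (Word n) 0ℓ
𝒲 k n w = IsWeakOrder w × weight w ≡ k

-- Drops the last letter; the empty word, which has none, is a junk case.
prefix : ∀ {n} → Word n → Word (pred n)
prefix []         = []
prefix w@(_ ∷ _)  = init w

𝒲⁻ : (k n : ℕ) → Pred (Word (pred n)) 0ℓ
𝒲⁻ k n u = ∃[ w ] (𝒲 k n w × prefix w ≡ u)

HasSize : ∀ {m} → Pred (Word m) 0ℓ → ℕ → Set
HasSize {m} C N = ∃[ xs ] (Unique {n = N} xs × (∀ (c : Word m) → c ∈ xs ⇔ C c))

-- The subword a_{i+1} a_{i+2} … a_{i+m}, with subscripts modulo N.  It may wrap
-- around a more than once, since m is allowed to exceed N.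
subword : ∀ {N} (m : ℕ) → Word N → Fin N → Word m
subword {N} m a i = tabulate λ j → lookup a (_mod_ (toℕ i + suc (toℕ j)) N {{nonZeroIndex i}})

-- The field `sound` is implied by the other two, by counting.
record IsUCycle {m N : ℕ} (C : Pred (Word m) 0ℓ) (a : Word N) : Set where
  field
    size   : HasSize C N
    occurs : ∀ c → C c → ∃! _≡_ λ (i : Fin N) → subword m a i ≡ c
    sound  : ∀ i → C (subword m a i)

{-# OPTIONS --safe #-}
module Submission where

-- Read 𝒲⁻ k n as the edges of a graph on the words of length n − 2, e leading from
-- init e to tail e; a universal cycle is an Eulerian circuit, read off by first letters.
-- Rotating an edge gives an edge, so the edges split into pure cycles.  A closed trail
-- that is a union of pure cycles absorbs the pure cycle of any edge e′ that shares its
-- end vertex with an edge of the trail, until no such e′ is left outside.  The trail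
-- is then everything: in terms of words of 𝒲 k n, it is closed under permuting letters
-- and under replacing two letters by two others of the same sum.  Raising a repeated
-- minimal letter and lowering a maximal one, level by level from below, brings the
-- content of a weak order into a normal form determined by n and k alone.

open import Defs
open import Data.Empty using (⊥; ⊥-elim)
open import Data.Fin using (Fin; zero; suc; toℕ; inject₁)
open import Data.Fin.Properties using (toℕ-fromℕ<; toℕ<n; toℕ-injective; toℕ-inject₁)
open import Data.List using (List; []; _∷_; _++_; [_]; length; replicate; filter; upTo; applyUpTo; cartesianProductWith)
open import Data.List.Membership.Propositional using (_∈_; _∉_; find; lose)
open import Data.List.Membership.Propositional.Properties using (∈-++⁺ˡ; ∈-++⁺ʳ; ∈-++⁻; ∈-upTo⁺; ∈-applyUpTo⁺; ∈-applyUpTo⁻; ∈-cartesianProductWith⁺; ∈-filter⁺; ∈-filter⁻)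
import Data.List.Membership.DecPropositional as DecMembership
open import Data.List.Properties using (length-++; length-replicate; ++-assoc; ++-identityʳ; filter-notAll; ∷-injective)
open import Data.List.Relation.Binary.Permutation.Propositional using (_↭_; refl; prep; swap; trans; ↭-sym; ↭-reflexive; ↭-trans; ↭⇒↭ₛ)
open import Data.List.Relation.Binary.Permutation.Propositional.Properties using (++-comm; ++⁺ˡ; ↭-length; ∈-resp-↭; ∷↭∷ʳ) renaming (shift to ↭-shift)
import Data.List.Relation.Binary.Permutation.Setoid.Properties as ↭ₛ
open import Data.List.Relation.Unary.All as All using (All)
import Data.List.Relation.Unary.AllPairs as ListAllPairs
open import Data.List.Relation.Unary.Any as Any using (here; there)
open import Data.List.Relation.Unary.Any.Properties using (¬Any[])
open import Data.List.Relation.Unary.Unique.Propositional using (Unique)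
open import Data.List.Relation.Unary.Unique.Propositional.Properties using (applyUpTo⁺₁) renaming (++⁺ to unique-++⁺)
open import Data.Nat
open import Data.Nat.Combinatorics using (_C_)
open import Data.Nat.DivMod
open import Data.Nat.GeneralisedArithmetic using (iterate)
open import Data.Nat.Induction using (Acc; acc; <-wellFounded)
open import Data.Nat.ListAction using (sum)
open import Data.Nat.ListAction.Properties using (sum-++; sum-↭)
open import Data.Nat.Properties
open import Data.Nat.Tactic.RingSolver using (solve-∀)
open import Data.Product using (_×_; _,_; ∃-syntax; Σ-syntax; proj₁; proj₂)
open import Data.Sum using (_⊎_; inj₁; inj₂; [_,_]′)
open import Data.Vec as Vec using (Vec; toList; fromList; head; tail; init; lookup; tabulate; _∷ʳ_)
import Data.Vec.Membership.Propositional as Vec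
open import Data.Vec.Membership.Propositional.Properties using (∈-toList⁺; ∈-toList⁻; ∈-fromList⁺; ∈-fromList⁻; ∈-lookup)
import Data.Vec.Properties as Vec
open import Data.Vec.Relation.Binary.Equality.Cast using (cast-is-id)
import Data.Vec.Relation.Unary.All.Properties as VecAll
import Data.Vec.Relation.Unary.AllPairs as VecAllPairs
import Data.Vec.Relation.Unary.Any as VecAny
import Data.Vec.Relation.Unary.Any.Properties as VecAny
import Data.Vec.Relation.Unary.Unique.Propositional as Vec
import Data.Vec.Relation.Unary.Unique.Propositional.Properties as Vec
open import Function using (_⇔_; mk⇔; Equivalence; _∘_)
open import Level using (0ℓ)
open import Relation.Binary.Construct.Closure.Equivalence as Eq using (EqClosure)
open import Relation.Binary.Construct.Closure.ReflexiveTransitive using (ε; _◅_; _◅◅_)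
open import Relation.Binary.Construct.Closure.Symmetric using (fwd; bwd)
open import Relation.Binary.PropositionalEquality as ≡ using (_≡_; _≢_; cong; cong₂; sym; subst; subst₂; module ≡-Reasoning)
import Relation.Binary.PropositionalEquality.Properties as ≡
open import Relation.Nullary using (Dec; yes; no; ¬_; ¬?)
open import Relation.Nullary.Decidable using (map′; _×-dec_)
open import Relation.Unary using (Pred; Decidable)

-- Contents of weak orders

-- blocks c [ m₀ , m₁ , … ] has suc mᵢ letters c + i: every weak order is, up to
-- order, some blocks 0 ms.
blocks : ℕ → List ℕ → List ℕ
blocks c []       = []
blocks c (m ∷ ms) = replicate (suc m) c ++ blocks (suc c) ms

size : List ℕ → ℕ
size []       = 0
size (m ∷ ms) = suc m + size ms

-- This is the weight of `blocks 0 ms`, counted level by level: a letter of height i is counted once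
-- at each of the i levels below it.
excess : List ℕ → ℕ
excess []       = 0
excess (m ∷ ms) = size ms + excess ms

length-blocks : ∀ c ms → length (blocks c ms) ≡ size ms
length-blocks c []       = ≡.refl
length-blocks c (m ∷ ms) = ≡.trans (length-++ (replicate (suc m) c))
  (cong₂ _+_ (length-replicate (suc m)) (length-blocks (suc c) ms))

sum-replicate : ∀ m c → sum (replicate m c) ≡ m * c
sum-replicate zero    c = ≡.refl
sum-replicate (suc m) c = cong (c +_) (sum-replicate m c)

sum-blocks : ∀ c ms → sum (blocks c ms) ≡ size ms * c + excess ms
sum-blocks c []       = ≡.refl
sum-blocks c (m ∷ ms) = begin
  sum (replicate (suc m) c ++ blocks (suc c) ms)           ≡⟨ sum-++ (replicate (suc m) c) _ ⟩
  sum (replicate (suc m) c) + sum (blocks (suc c) ms)      ≡⟨ cong₂ _+_ (sum-replicate (suc m) c) (sum-blocks (suc c) ms) ⟩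
  suc m * c + (size ms * suc c + excess ms)                ≡⟨ regroup (suc m) c (size ms) (excess ms) ⟩
  (suc m + size ms) * c + (size ms + excess ms)            ∎
  where
  open ≡-Reasoning
  regroup : ∀ m c s e → m * c + (s * suc c + e) ≡ (m + s) * c + (s + e)
  regroup = solve-∀

-- Two letters are replaced by two others of the same sum. Permutations on both sides bring these
-- letters to the front, where `exchange` acts.
_⇝_ : List ℕ → List ℕ → Set
w ⇝ w′ = ∃[ x ] ∃[ y ] ∃[ x′ ] ∃[ y′ ] ∃[ us ]
  (x + y ≡ x′ + y′ × w ↭ x ∷ y ∷ us × w′ ↭ x′ ∷ y′ ∷ us)

⇝-sym : ∀ {w w′} → w ⇝ w′ → w′ ⇝ w
⇝-sym (x , y , x′ , y′ , us , eq , p , p′) = x′ , y′ , x , y , us , sym eq , p′ , p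

⇝-length : ∀ {w w′} → w ⇝ w′ → length w ≡ length w′
⇝-length (_ , _ , _ , _ , _ , _ , p , p′) = ≡.trans (↭-length p) (sym (↭-length p′))

⇝-sum : ∀ {w w′} → w ⇝ w′ → sum w ≡ sum w′
⇝-sum {w} {w′} (x , y , x′ , y′ , us , eq , p , p′) = begin
  sum w              ≡⟨ sum-↭ p ⟩
  x + (y + sum us)   ≡⟨ +-assoc x y _ ⟨
  x + y + sum us     ≡⟨ cong (_+ sum us) eq ⟩
  x′ + y′ + sum us   ≡⟨ +-assoc x′ y′ _ ⟩
  x′ + (y′ + sum us) ≡⟨ sum-↭ p′ ⟨
  sum w′             ∎
  where open ≡-Reasoning

shift₂ : ∀ (x y : ℕ) as us → as ++ x ∷ y ∷ us ↭ x ∷ y ∷ as ++ us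
shift₂ x y as us = ↭-trans (↭-shift x as (y ∷ us)) (prep x (↭-shift y as us))

⇝-++⁺ˡ : ∀ as {w w′} → w ⇝ w′ → (as ++ w) ⇝ (as ++ w′)
⇝-++⁺ˡ as (x , y , x′ , y′ , us , eq , p , p′) =
  x , y , x′ , y′ , as ++ us , eq ,
  ↭-trans (++⁺ˡ as p) (shift₂ x y as us) , ↭-trans (++⁺ˡ as p′) (shift₂ x′ y′ as us)

-- Lowers one letter of maximal height by one, in the content p ∷ q ∷ rs.
lower : ℕ → ℕ → List ℕ → List ℕ
lower p q       (r ∷ rs) = p ∷ lower q r rs
lower p zero    []       = suc p ∷ []
lower p (suc q) []       = suc p ∷ q ∷ []

blocks-lower : ∀ c p q rs → ∃[ h ] ∃[ us ]
  (blocks c (p ∷ q ∷ rs) ↭ suc h ∷ us × blocks c (lower p q rs) ↭ h ∷ us)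
blocks-lower c p zero [] =
  c , replicate (suc p) c ++ [] , ↭-shift (suc c) (replicate (suc p) c) [] , refl
blocks-lower c p (suc q) [] =
  c , replicate (suc p) c ++ replicate (suc q) (suc c) ++ [] ,
  ↭-shift (suc c) (replicate (suc p) c) _ , refl
blocks-lower c p q (r ∷ rs) with blocks-lower (suc c) q r rs
... | h , us , π , π′ = h , replicate (suc p) c ++ us ,
  ↭-trans (++⁺ˡ (replicate (suc p) c) π) (↭-shift (suc h) (replicate (suc p) c) us) ,
  ↭-trans (++⁺ˡ (replicate (suc p) c) π′) (↭-shift h (replicate (suc p) c) us)

-- The raised letter joins the first of these levels, and `lower` never takes a letter away from
-- that level.
blocks-lower-suc : ∀ c p q rs → blocks c (lower (suc p) q rs) ≡ c ∷ blocks c (lower p q rs)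
blocks-lower-suc c p zero    []      = ≡.refl
blocks-lower-suc c p (suc q) []      = ≡.refl
blocks-lower-suc c p q      (r ∷ rs) = ≡.refl

infix 4 _⟶_ _≈_

-- A minimal letter that is not alone on its level is raised, a maximal letter at
-- least two levels above it is lowered.
data _⟶_ : List ℕ → List ℕ → Set where
  shift : ∀ m p q rs → suc m ∷ p ∷ q ∷ rs ⟶ m ∷ lower (suc p) q rs
  skip  : ∀ m {ms ns} → ms ⟶ ns → m ∷ ms ⟶ m ∷ ns

-- One letter rises from c to `suc c`, another sinks from `suc h` to h, so the sum is kept.
⟶⇒⇝ : ∀ {ms ns} → ms ⟶ ns → ∀ c → blocks c ms ⇝ blocks c ns
⟶⇒⇝ (skip m s) c = ⇝-++⁺ˡ (replicate (suc m) c) (⟶⇒⇝ s (suc c))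
⟶⇒⇝ (shift m p q rs) c with blocks-lower (suc c) p q rs
... | h , us , π , π′ = c , suc h , suc c , h , replicate (suc m) c ++ us , +-suc c h ,
  prep c (↭-trans (++⁺ˡ (replicate (suc m) c) π) (↭-shift (suc h) (replicate (suc m) c) us)) ,
  ↭-trans (++⁺ˡ (replicate (suc m) c)
            (↭-trans (↭-reflexive (blocks-lower-suc (suc c) p q rs)) (prep (suc c) π′)))
          (shift₂ (suc c) h (replicate (suc m) c) us)

_≈_ : List ℕ → List ℕ → Set
_≈_ = EqClosure _⟶_

⟶-size : ∀ {ms ns} → ms ⟶ ns → size ms ≡ size ns
⟶-size {ms} {ns} s = ≡.trans (sym (length-blocks 0 ms))
  (≡.trans (⇝-length (⟶⇒⇝ s 0)) (length-blocks 0 ns))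

sum-blocks₀ : ∀ ms → sum (blocks 0 ms) ≡ excess ms
sum-blocks₀ ms = ≡.trans (sum-blocks 0 ms) (simplify (size ms) (excess ms))
  where
  simplify : ∀ s e → s * 0 + e ≡ e
  simplify = solve-∀

⟶-excess : ∀ {ms ns} → ms ⟶ ns → excess ms ≡ excess ns
⟶-excess {ms} {ns} s = ≡.trans (sym (sum-blocks₀ ms))
  (≡.trans (⇝-sum (⟶⇒⇝ s 0)) (sum-blocks₀ ns))

≈-size : ∀ {ms ns} → ms ≈ ns → size ms ≡ size ns
≈-size = Eq.gfold ≡.isEquivalence size ⟶-size

≈-excess : ∀ {ms ns} → ms ≈ ns → excess ms ≡ excess ns
≈-excess = Eq.gfold ≡.isEquivalence excess ⟶-excess

data Flat : List ℕ → Set where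
  one : ∀ m → Flat (m ∷ [])
  two : ∀ m q → Flat (m ∷ q ∷ [])

-- The contents whose bottom level admits no `shift`: at most two levels, or a single minimal
-- letter.
data Reduced : List ℕ → Set where
  none : Reduced []
  flat : ∀ {ms} → Flat ms → Reduced ms
  tall : ∀ p q rs → Reduced (0 ∷ p ∷ q ∷ rs)

-- Each `shift` takes a letter off the bottom level, which gives the recursion on m. The number of
-- levels may drop on the way, so the shape is examined anew each time.
reduce : ∀ ms → ∃[ ns ] (Reduced ns × ms ≈ ns)
reduce []       = [] , none , ε
reduce (m ∷ ms) = go m ms
  where
  go : ∀ m ms → ∃[ ns ] (Reduced ns × m ∷ ms ≈ ns)
  go m       []           = _ , flat (one m) , ε
  go m       (q ∷ [])     = _ , flat (two m q) , ε
  go zero    (p ∷ q ∷ rs) = _ , tall p q rs , ε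
  go (suc m) (p ∷ q ∷ rs) with go m (lower (suc p) q rs)
  ... | ns , red , eq = ns , red , fwd (shift m p q rs) ◅ eq

-- This and `tall⇒size≤excess` separate the two kinds of reduced content. With at most two levels
-- the weight counts the letters of the upper one; a tall content has all letters but one above the
-- bottom, and at least one of them at height two.
flat⇒excess<size : ∀ {ms} → Flat ms → excess ms < size ms
flat⇒excess<size (one m)   = s≤s z≤n
flat⇒excess<size (two m q) =
  subst (_< suc m + (suc q + 0)) (sym (+-identityʳ (suc q + 0))) (m<n+m (suc q + 0) (s≤s z≤n))

tall⇒size≤excess : ∀ p q rs → size (0 ∷ p ∷ q ∷ rs) ≤ excess (0 ∷ p ∷ q ∷ rs)
tall⇒size≤excess p q rs = subst (_≤ s + suc (q + size rs + e)) (+-comm s 1) (+-monoʳ-≤ s (s≤s z≤n))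
  where
  s = size (p ∷ q ∷ rs)
  e = excess (q ∷ rs)

tall≢flat : ∀ p q rs {ms} → Flat ms → size (0 ∷ p ∷ q ∷ rs) ≡ size ms →
  excess (0 ∷ p ∷ q ∷ rs) ≢ excess ms
tall≢flat p q rs f s≡ e≡ = <⇒≱ (flat⇒excess<size f) (subst₂ _≤_ s≡ e≡ (tall⇒size≤excess p q rs))

-- The excess is the size of the upper level, or 0 if there is none; the total size then fixes the
-- lower level.
flat-unique : ∀ {ms ns} → Flat ms → Flat ns → size ms ≡ size ns → excess ms ≡ excess ns → ms ≡ ns
flat-unique (one m)   (one m′)    s≡ e≡ = cong (_∷ []) (suc-injective (+-cancelʳ-≡ 0 _ _ s≡))
flat-unique (one m)   (two m′ q′) s≡ ()
flat-unique (two m q) (one m′)    s≡ ()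
flat-unique (two m q) (two m′ q′) s≡ e≡
  with ≡.refl ← suc-injective (+-cancelʳ-≡ 0 (suc q) (suc q′) (+-cancelʳ-≡ 0 _ _ e≡))
  = cong (_∷ q ∷ []) (suc-injective (+-cancelʳ-≡ (suc q + 0) _ _ s≡))

-- Both contents are reduced at the bottom level and then compared. The recursion is on the number
-- of letters, as reduction does not respect the structure of the lists.
connected : ∀ ms ns → size ms ≡ size ns → excess ms ≡ excess ns → ms ≈ ns
connected ms ns s≡ e≡ = go (size ms) ms ns ≡.refl s≡ e≡
  where
  go : ∀ s ms ns → size ms ≡ s → size ms ≡ size ns → excess ms ≡ excess ns → ms ≈ ns
  reduced : ∀ s {ms ns} → Reduced ms → Reduced ns →
    size ms ≡ s → size ms ≡ size ns → excess ms ≡ excess ns → ms ≈ ns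

  go s ms ns ≡s s≡ e≡ with reduce ms | reduce ns
  ... | ms′ , red , eq | ns′ , red′ , eq′ =
    eq ◅◅ reduced s red red′ (≡.trans (sym (≈-size eq)) ≡s)
            (≡.trans (sym (≈-size eq)) (≡.trans s≡ (≈-size eq′)))
            (≡.trans (sym (≈-excess eq)) (≡.trans e≡ (≈-excess eq′)))
       ◅◅ Eq.symmetric _⟶_ eq′

  reduced s none           none              ≡s s≡ e≡ = ε
  reduced s none           (flat (one m))    ≡s () e≡
  reduced s none           (flat (two m q))  ≡s () e≡
  reduced s none           (tall p q rs)     ≡s () e≡
  reduced s (flat (one m)) none              ≡s () e≡
  reduced s (flat (two m q)) none            ≡s () e≡
  reduced s (flat f)       (flat f′)         ≡s s≡ e≡ =
    ≡.subst (_ ≈_) (flat-unique f f′ s≡ e≡) ε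
  reduced s (flat f)       (tall p q rs)     ≡s s≡ e≡ = ⊥-elim (tall≢flat p q rs f (sym s≡) (sym e≡))
  reduced s (tall p q rs)  none              ≡s () e≡
  reduced s (tall p q rs)  (flat f)          ≡s s≡ e≡ = ⊥-elim (tall≢flat p q rs f s≡ e≡)
  -- Both bottom levels hold a single letter. The levels above have one letter fewer and, after
  -- cancelling their common size, equal excess.
  reduced (suc s) (tall p q rs) (tall p′ q′ rs′) ≡s s≡ e≡ =
    Eq.gmap (0 ∷_) (skip 0)
      (go s (p ∷ q ∷ rs) (p′ ∷ q′ ∷ rs′) (suc-injective ≡s) s≡′
        (+-cancelˡ-≡ (size (p ∷ q ∷ rs)) _ _
          (≡.trans e≡ (cong (_+ excess (p′ ∷ q′ ∷ rs′)) (sym s≡′)))))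
    where
    s≡′ = suc-injective s≡

-- Connectivity

IsOrderList : Pred (List ℕ) 0ℓ
IsOrderList w = ∃[ ms ] w ↭ blocks 0 ms

isOrderList-↭ : ∀ {w w′} → w ↭ w′ → IsOrderList w → IsOrderList w′
isOrderList-↭ π (ms , π₀) = ms , ↭-trans (↭-sym π) π₀

-- The edge of the word y ∷ es is es, with its dropped letter y in front.  `rotate` is
-- closure under the pure cycle of es, `exchange` under edges leading to the same vertex.
record Closed (Q : Pred (List ℕ) 0ℓ) : Set where
  field
    rotate   : ∀ {y x us} → Q (y ∷ x ∷ us) → Q (y ∷ us ++ [ x ])
    exchange : ∀ {y x y′ x′ us} → y + x ≡ y′ + x′ → IsOrderList (y′ ∷ x′ ∷ us) →
               Q (y ∷ x ∷ us) → Q (y′ ∷ x′ ∷ us)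

module _ {Q : Pred (List ℕ) 0ℓ} (closed : Closed Q) where
  open Closed closed

  rotate* : ∀ y as bs → Q (y ∷ as ++ bs) → Q (y ∷ bs ++ as)
  rotate* y []       bs q = subst (λ es → Q (y ∷ es)) (sym (++-identityʳ bs)) q
  rotate* y (x ∷ as) bs q =
    subst (λ es → Q (y ∷ es)) (++-assoc bs [ x ] as)
      (rotate* y as (bs ++ [ x ])
        (subst (λ es → Q (y ∷ es)) (++-assoc as bs [ x ]) (rotate q)))

  Reached : Pred (List ℕ) 0ℓ
  Reached w = IsOrderList w × Q w

  -- Rotate x to the front of the edge, exchange it with the dropped letter y, and rotate back.
  swap-head : ∀ y as x bs → Reached (y ∷ as ++ x ∷ bs) → Reached (x ∷ as ++ y ∷ bs)
  swap-head y as x bs (o , q) =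
    isOrderList-↭ (↭-trans π (prep x (++-comm (y ∷ bs) as))) o ,
    rotate* x (y ∷ bs) as (exchange (+-comm y x) (isOrderList-↭ π o) (rotate* y as (x ∷ bs) q))
    where
    π : y ∷ as ++ x ∷ bs ↭ x ∷ y ∷ bs ++ as
    π = ↭-trans (prep y (++-comm as (x ∷ bs))) (swap y x refl)

  -- Away from the front, the transposition of x and y is a product of three swaps with the dropped
  -- letter z.
  swap-at : ∀ as x y us → Reached (as ++ x ∷ y ∷ us) → Reached (as ++ y ∷ x ∷ us)
  swap-at []       x y us (o , q) = o′ , exchange (+-comm x y) o′ q
    where o′ = isOrderList-↭ (swap x y refl) o
  swap-at (z ∷ as) x y us r =
    swap-head y as z (x ∷ us)
      (subst (λ es → Reached (y ∷ es)) (++-assoc as [ z ] (x ∷ us))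
        (swap-head x (as ++ [ z ]) y us
          (subst (λ es → Reached (x ∷ es)) (sym (++-assoc as [ z ] (y ∷ us)))
            (swap-head z as x (y ∷ us) r))))

  -- `Q` speaks of whole words and is not inherited by their tails, so the letters already passed
  -- are kept in the prefix `as` of the induction.
  reached-↭ : ∀ {xs ys} → xs ↭ ys → Reached xs → Reached ys
  reached-↭ = go []
    where
    under : ∀ as x {xs ys} → (Reached ((as ++ [ x ]) ++ xs) → Reached ((as ++ [ x ]) ++ ys)) →
            Reached (as ++ x ∷ xs) → Reached (as ++ x ∷ ys)
    under as x {xs} {ys} f r =
      subst Reached (++-assoc as [ x ] ys) (f (subst Reached (sym (++-assoc as [ x ] xs)) r))
    go : ∀ as {xs ys} → xs ↭ ys → Reached (as ++ xs) → Reached (as ++ ys)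
    go as refl         r = r
    go as (prep x π)   r = under as x (go (as ++ [ x ]) π) r
    go as (swap x y π) r =
      under as y (under (as ++ [ y ]) x (go ((as ++ [ y ]) ++ [ x ]) π)) (swap-at as x y _ r)
    go as (trans π π′) r = go as π′ (go as π r)

  reached-⇝ : ∀ {w w′} → w ⇝ w′ → IsOrderList w′ → Reached w → Reached w′
  reached-⇝ (x , y , x′ , y′ , us , x+y≡ , π , π′) o′ r with reached-↭ π r
  ... | _ , q = reached-↭ (↭-sym π′) (o″ , exchange x+y≡ o″ q)
    where o″ = isOrderList-↭ π′ o′

  -- Every intermediate content is again some `blocks 0 ks`, so each exchange ends in a weak order,
  -- as `exchange` demands.
  reached-≈ : ∀ {ms ns} → ms ≈ ns → Reached (blocks 0 ms) → Reached (blocks 0 ns)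
  reached-≈ ε           r = r
  reached-≈ (_◅_ {j = ks} (fwd s) e) r = reached-≈ e (reached-⇝ (⟶⇒⇝ s 0) (ks , refl) r)
  reached-≈ (_◅_ {j = ks} (bwd s) e) r = reached-≈ e (reached-⇝ (⇝-sym (⟶⇒⇝ s 0)) (ks , refl) r)

  closed⇒all : ∀ {w w′} → IsOrderList w → IsOrderList w′ → length w ≡ length w′ → sum w ≡ sum w′ →
    Q w → Q w′
  closed⇒all {w} {w′} o@(ms , π) (ns , π′) length≡ sum≡ q =
    proj₂ (reached-↭ (↭-sym π′) (reached-≈ (connected ms ns size≡ excess≡) (reached-↭ π (o , q))))
    where
    open ≡-Reasoning
    size≡ : size ms ≡ size ns
    size≡ = begin
      size ms              ≡⟨ length-blocks 0 ms ⟨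
      length (blocks 0 ms) ≡⟨ ↭-length π ⟨
      length w             ≡⟨ length≡ ⟩
      length w′            ≡⟨ ↭-length π′ ⟩
      length (blocks 0 ns) ≡⟨ length-blocks 0 ns ⟩
      size ns              ∎
    excess≡ : excess ms ≡ excess ns
    excess≡ = begin
      excess ms         ≡⟨ sum-blocks₀ ms ⟨
      sum (blocks 0 ms) ≡⟨ sum-↭ π ⟨
      sum w             ≡⟨ sum≡ ⟩
      sum w′            ≡⟨ sum-↭ π′ ⟩
      sum (blocks 0 ns) ≡⟨ sum-blocks₀ ns ⟩
      excess ns         ∎

-- Weak orders as words

record Interval (c d : ℕ) (w : List ℕ) : Set where
  field
    lower-bound : ∀ {v} → v ∈ w → c ≤ v
    upper-bound : ∀ {v} → v ∈ w → v < d
    full        : ∀ {v} → c ≤ v → v < d → v ∈ w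
open Interval

∈-replicate⁻ : ∀ {v x : ℕ} n → v ∈ replicate n x → v ≡ x
∈-replicate⁻ (suc n) (here v≡x) = v≡x
∈-replicate⁻ (suc n) (there i)  = ∈-replicate⁻ n i

∈-blocks⁻ : ∀ c ms {v} → v ∈ blocks c ms → c ≤ v × v < c + length ms
∈-blocks⁻ c (m ∷ ms) i with ∈-++⁻ (replicate (suc m) c) i
... | inj₁ j with ≡.refl ← ∈-replicate⁻ (suc m) j = ≤-refl , m<m+n c (s≤s z≤n)
... | inj₂ j with ∈-blocks⁻ (suc c) ms j
... | c<v , v< = <⇒≤ c<v , ≤-trans v< (≤-reflexive (sym (+-suc c (length ms))))

∈-blocks⁺ : ∀ c ms {v} → c ≤ v → v < c + length ms → v ∈ blocks c ms
∈-blocks⁺ c []       c≤v v< = ⊥-elim (<⇒≱ v< (subst (_≤ _) (sym (+-identityʳ c)) c≤v))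
∈-blocks⁺ c (m ∷ ms) {v} c≤v v< with c ≟ v
... | yes c≡v = here (sym c≡v)
... | no  c≢v = ∈-++⁺ʳ (replicate (suc m) c)
  (∈-blocks⁺ (suc c) ms (≤∧≢⇒< c≤v c≢v) (≤-trans v< (≤-reflexive (+-suc c (length ms)))))

interval-blocks : ∀ c ms → Interval c (c + length ms) (blocks c ms)
interval-blocks c ms = record
  { lower-bound = λ i → proj₁ (∈-blocks⁻ c ms i)
  ; upper-bound = λ i → proj₂ (∈-blocks⁻ c ms i)
  ; full        = ∈-blocks⁺ c ms
  }

interval-↭ : ∀ {c d w w′} → w ↭ w′ → Interval c d w → Interval c d w′
interval-↭ π int = record
  { lower-bound = λ i → lower-bound int (∈-resp-↭ (↭-sym π) i)
  ; upper-bound = λ i → upper-bound int (∈-resp-↭ (↭-sym π) i)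
  ; full        = λ c≤v v<d → ∈-resp-↭ π (full int c≤v v<d)
  }

separate : ∀ c w → ∃[ n ] ∃[ w′ ] (w ↭ replicate n c ++ w′ × c ∉ w′)
separate c []      = 0 , [] , refl , λ ()
separate c (x ∷ w) with separate c w
... | n , w′ , π , c∉w′ with c ≟ x
... | yes ≡.refl = suc n , w′ , prep c π , c∉w′
... | no  c≢x    = n , x ∷ w′ , ↭-trans (prep x π) (↭-sym (↭-shift x (replicate n c) w′)) ,
                   λ { (here c≡x) → c≢x c≡x ; (there i) → c∉w′ i }

-- The copies of the least letter c are split off. Fullness provides at least one of them, and the
-- other letters form an interval from `suc c`.
interval⇒blocks : ∀ k c {w} → Interval c (c + k) w → ∃[ ms ] w ↭ blocks c ms
interval⇒blocks zero c {[]}    int = [] , refl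
interval⇒blocks zero c {x ∷ w} int = ⊥-elim (<⇒≱ (upper-bound int (here ≡.refl))
  (subst (_≤ x) (sym (+-identityʳ c)) (lower-bound int (here ≡.refl))))
interval⇒blocks (suc k) c {w} int with separate c w
... | zero , w′ , π , c∉w′ = ⊥-elim (c∉w′ (∈-resp-↭ π (full int ≤-refl (m<m+n c (s≤s z≤n)))))
... | suc m , w′ , π , c∉w′ with interval⇒blocks k (suc c) {w′} int′
  where
  into : ∀ {v} → v ∈ w′ → v ∈ w
  into i = ∈-resp-↭ (↭-sym π) (∈-++⁺ʳ (replicate (suc m) c) i)
  full′ : ∀ {v} → c < v → v < suc c + k → v ∈ w′
  full′ c<v v< with ∈-++⁻ (replicate (suc m) c)
                     (∈-resp-↭ π (full int (<⇒≤ c<v) (≤-trans v< (≤-reflexive (sym (+-suc c k))))))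
  ... | inj₁ i = ⊥-elim (<⇒≢ c<v (sym (∈-replicate⁻ (suc m) i)))
  ... | inj₂ i = i
  int′ : Interval (suc c) (suc c + k) w′
  int′ = record
    { lower-bound = λ i → ≤∧≢⇒< (lower-bound int (into i)) λ { ≡.refl → c∉w′ i }
    ; upper-bound = λ i → ≤-trans (upper-bound int (into i)) (≤-reflexive (+-suc c k))
    ; full        = full′
    }
... | ms , π′ = m ∷ ms , ↭-trans π (++⁺ˡ (replicate (suc m) c) π′)

length≤size : ∀ ms → length ms ≤ size ms
length≤size []       = z≤n
length≤size (m ∷ ms) = s≤s (≤-trans (length≤size ms) (m≤n+m _ m))

isOrderList⇒interval : ∀ {w} → IsOrderList w → ∃[ d ] (d ≤ length w × Interval 0 d w)
isOrderList⇒interval {w} (ms , π) = length ms ,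
  subst (length ms ≤_) (≡.trans (sym (length-blocks 0 ms)) (sym (↭-length π))) (length≤size ms) ,
  interval-↭ (↭-sym π) (interval-blocks 0 ms)

interval? : ∀ d w → Dec (Interval 0 d w)
interval? d w = map′ to from (All.all? (_<? d) w ×-dec allUpTo? (_∈? w) d)
  where
  open DecMembership _≟_ using (_∈?_)
  to : All (_< d) w × (∀ {v} → v < d → v ∈ w) → Interval 0 d w
  to (below , full) = record
    { lower-bound = λ _ → z≤n
    ; upper-bound = All.lookup below
    ; full        = λ _ v<d → full v<d
    }
  from : Interval 0 d w → All (_< d) w × (∀ {v} → v < d → v ∈ w)
  from int = All.tabulate (upper-bound int) , full int z≤n

-- The number of levels is at most the length of the word, so a bounded search decides.
isOrderList? : Decidable IsOrderList
isOrderList? w = map′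
  (λ (d , _ , int) → interval⇒blocks d 0 int)
  (λ o → let d , d≤ , int = isOrderList⇒interval o in d , s≤s d≤ , int)
  (anyUpTo? (λ d → interval? d w) (suc (length w)))

isWeakOrder⇒isOrderList : ∀ {n} {w : Word n} → IsWeakOrder w → IsOrderList (toList w)
isWeakOrder⇒isOrderList (h , _ , letters) = interval⇒blocks (suc h) 0 record
  { lower-bound = λ _ → z≤n
  ; upper-bound = λ i → s≤s (Equivalence.to (letters _) (∈-toList⁻ i))
  ; full        = λ { _ (s≤s v≤h) → ∈-toList⁺ (Equivalence.from (letters _) v≤h) }
  }

isOrderList⇒isWeakOrder : ∀ {n} {w : Word (suc n)} → IsOrderList (toList w) → IsWeakOrder w
isOrderList⇒isWeakOrder {w = w} o with isOrderList⇒interval o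
-- A nonempty word has at least one level.
isOrderList⇒isWeakOrder {w = x Vec.∷ _} o | zero , _ , int with () ← upper-bound int (here ≡.refl)
isOrderList⇒isWeakOrder {w = w} o | suc h , h< , int =
  h , subst (h <_) (Vec.length-toList w) h< , λ v → mk⇔
    (λ i → s≤s⁻¹ (upper-bound int (∈-toList⁺ i)))
    (λ v≤h → ∈-toList⁻ (full int z≤n (s≤s v≤h)))

sum-toList : ∀ {n} (w : Word n) → sum (toList w) ≡ weight w
sum-toList Vec.[]      = ≡.refl
sum-toList (x Vec.∷ w) = cong (x +_) (sum-toList w)

-- y is the letter dropped by prefix; all words are taken up to order, so it can stand in front.
IsEdge : ℕ → ∀ {m} → Pred (Word m) 0ℓ
IsEdge k e = ∃[ y ] (IsOrderList (y ∷ toList e) × y + weight e ≡ k)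

toList-∷ʳ-↭ : ∀ {m} (e : Word m) y → y ∷ toList e ↭ toList (e Vec.∷ʳ y)
toList-∷ʳ-↭ e y = subst (y ∷ toList e ↭_) (sym (Vec.toList-∷ʳ y e)) (∷↭∷ʳ y (toList e))

weight-∷ʳ : ∀ {m} (e : Word m) y → y + weight e ≡ weight (e Vec.∷ʳ y)
weight-∷ʳ e y = begin
  y + weight e                 ≡⟨ cong (y +_) (sum-toList e) ⟨
  sum (y ∷ toList e)           ≡⟨ sum-↭ (toList-∷ʳ-↭ e y) ⟩
  sum (toList (e Vec.∷ʳ y))    ≡⟨ sum-toList (e Vec.∷ʳ y) ⟩
  weight (e Vec.∷ʳ y)          ∎
  where open ≡-Reasoning

isEdge⇒𝒲⁻ : ∀ {k m} {e : Word (suc m)} → IsEdge k e → 𝒲⁻ k (suc (suc m)) e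
isEdge⇒𝒲⁻ {e = e@(_ Vec.∷ _)} (y , o , ≡k) =
  e Vec.∷ʳ y ,
  (isOrderList⇒isWeakOrder (isOrderList-↭ (toList-∷ʳ-↭ e y) o) ,
   ≡.trans (sym (weight-∷ʳ e y)) ≡k) ,
  Vec.init-∷ʳ y e

𝒲⁻⇒isEdge : ∀ {k m} {e : Word (suc m)} → 𝒲⁻ k (suc (suc m)) e → IsEdge k e
𝒲⁻⇒isEdge (w , (o , ≡k) , prefix≡) with Vec.initLast w
𝒲⁻⇒isEdge (w , (o , ≡k) , prefix≡) | e@(_ Vec.∷ _) , y , ≡.refl
  with ≡.refl ← ≡.trans (sym (Vec.init-∷ʳ y e)) prefix≡ =
  y , isOrderList-↭ (↭-sym (toList-∷ʳ-↭ e y)) (isWeakOrder⇒isOrderList o) ,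
  ≡.trans (weight-∷ʳ e y) ≡k

-- The weight leaves a single candidate for the dropped letter, `k ∸ weight e`.
isEdge? : ∀ k {m} → Decidable (IsEdge k {m})
isEdge? k e with weight e ≤? k
... | no  ≰k = no λ (y , _ , ≡k) → ≰k (subst (weight e ≤_) ≡k (m≤n+m _ y))
... | yes ≤k = map′ (λ o → k ∸ weight e , o , m∸n+n≡m ≤k)
  (λ (y , o , ≡k) → subst (λ y → IsOrderList (y ∷ toList e))
    (≡.trans (sym (m+n∸n≡m y (weight e))) (cong (_∸ weight e) ≡k)) o)
  (isOrderList? (k ∸ weight e ∷ toList e))

-- A finite list containing all edges: no letter of an edge exceeds its weight, which is at most k.
boundedWords : ∀ m → ℕ → List (Word m)
boundedWords zero    k = [ Vec.[] ]
boundedWords (suc m) k = cartesianProductWith Vec._∷_ (upTo (suc k)) (boundedWords m k)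

weight≤⇒∈-boundedWords : ∀ {m k} (e : Word m) → weight e ≤ k → e ∈ boundedWords m k
weight≤⇒∈-boundedWords Vec.[]      _  = here ≡.refl
weight≤⇒∈-boundedWords (x Vec.∷ e) ≤k = ∈-cartesianProductWith⁺ Vec._∷_
  (∈-upTo⁺ (s≤s (m+n≤o⇒m≤o x ≤k))) (weight≤⇒∈-boundedWords e (m+n≤o⇒n≤o x ≤k))

edges : ∀ k m → List (Word m)
edges k m = filter (isEdge? k) (boundedWords m k)

isEdge⇒∈-edges : ∀ {k m} {e : Word m} → IsEdge k e → e ∈ edges k m
isEdge⇒∈-edges {e = e} edge@(y , _ , ≡k) = ∈-filter⁺ (isEdge? _)
  (weight≤⇒∈-boundedWords e (subst (weight e ≤_) ≡k (m≤n+m _ y))) edge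

∈-edges⇒isEdge : ∀ {k m} {e : Word m} → e ∈ edges k m → IsEdge k e
∈-edges⇒isEdge {k} {m} i = proj₂ (∈-filter⁻ (isEdge? k) {xs = boundedWords m k} i)

-- Joining pure cycles

-- Edges are words of length suc m; e leads from the vertex init e to the vertex tail e.
data Trail {m} : Word m → List (Word (suc m)) → Word m → Set where
  []  : ∀ {u} → Trail u [] u
  _∷_ : ∀ {u e es v} → init e ≡ u → Trail (tail e) es v → Trail u (e ∷ es) v

trail-++ : ∀ {m} {u v w : Word m} {es fs} → Trail u es v → Trail v fs w → Trail u (es ++ fs) w
trail-++ []       t′ = t′
trail-++ (eq ∷ t) t′ = eq ∷ trail-++ t t′

-- The closed trail `fs` is spliced in directly behind e, at the end vertex of e.
trail-insert : ∀ {m} {u v : Word m} {e es fs} → Trail u es v → e ∈ es → Trail (tail e) fs (tail e) →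
  ∃[ gs ] (Trail u gs v × gs ↭ fs ++ es)
trail-insert {e = e} {e ∷ es} {fs} (eq ∷ t) (here ≡.refl) t′ =
  e ∷ fs ++ es , eq ∷ trail-++ t′ t , ↭-sym (↭-shift e fs es)
trail-insert {es = e ∷ es} {fs} (eq ∷ t) (there i) t′ with trail-insert t i t′
... | gs , t″ , π = e ∷ gs , eq ∷ t″ , ↭-trans (prep e π) (↭-sym (↭-shift e fs es))

rotate : ∀ {m} → Word (suc m) → Word (suc m)
rotate e = tail e ∷ʳ head e

rotate-injective : ∀ {m} {e e′ : Word (suc m)} → rotate e ≡ rotate e′ → e ≡ e′
rotate-injective {e = x Vec.∷ u} {x′ Vec.∷ u′} eq with Vec.∷ʳ-injective u u′ eq
... | ≡.refl , ≡.refl = ≡.refl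

rotations : ∀ {m} → ℕ → Word (suc m) → Word (suc m)
rotations n e = iterate rotate e n

rotations-+ : ∀ {m} i j (e : Word (suc m)) → rotations (i + j) e ≡ rotations j (rotations i e)
rotations-+ zero    j e = ≡.refl
rotations-+ (suc i) j e = rotations-+ i j (rotate e)

rotations-injective : ∀ {m} n {e e′ : Word (suc m)} → rotations n e ≡ rotations n e′ → e ≡ e′
rotations-injective zero    eq = eq
rotations-injective (suc n) {e} {e′} eq =
  rotate-injective (rotations-injective n {rotate e} {rotate e′} eq)

rotations-preserves : ∀ {m} {E : Pred (Word (suc m)) 0ℓ} → (∀ {e} → E e → E (rotate e)) →
  ∀ n {e} → E e → E (rotations n e)
rotations-preserves         closed zero    c = c
rotations-preserves {E = E} closed (suc n) c = rotations-preserves {E = E} closed n (closed c)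

toList-rotations : ∀ {m} (e : Word (suc m)) as bs → toList e ≡ as ++ bs →
  toList (rotations (length as) e) ≡ bs ++ as
toList-rotations e             []       bs eq = ≡.trans eq (sym (++-identityʳ bs))
toList-rotations (x Vec.∷ u) (a ∷ as) bs eq with ∷-injective eq
... | ≡.refl , eq′ = ≡.trans (toList-rotations (u ∷ʳ x) as (bs ++ [ x ]) (begin
  toList (u ∷ʳ x)        ≡⟨ Vec.toList-∷ʳ x u ⟩
  toList u ++ [ x ]      ≡⟨ cong (_++ [ x ]) eq′ ⟩
  (as ++ bs) ++ [ x ]    ≡⟨ ++-assoc as bs [ x ] ⟩
  as ++ bs ++ [ x ]      ∎)) (++-assoc bs [ x ] as)
  where open ≡-Reasoning

toList-injective : ∀ {n} (v w : Word n) → toList v ≡ toList w → v ≡ w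
toList-injective v w eq = ≡.trans (sym (cast-is-id ≡.refl v)) (Vec.toList-injective ≡.refl v w eq)

rotations-length : ∀ {m} (e : Word (suc m)) → rotations (suc m) e ≡ e
rotations-length {m} e = toList-injective _ e
  (subst (λ n → toList (rotations n e) ≡ toList e) (Vec.length-toList e)
    (toList-rotations e (toList e) [] (sym (++-identityʳ (toList e)))))

least : ∀ {P : Pred ℕ 0ℓ} → Decidable P → ∀ n → P n → ∃[ p ] (P p × (∀ q → q < p → ¬ P q))
least P? n pn with P? 0
least P? n       pn | yes p0 = 0 , p0 , λ _ ()
least P? zero    pn | no ¬p0 = ⊥-elim (¬p0 pn)
least P? (suc n) pn | no ¬p0 with least (P? ∘ suc) n pn
... | p , pp , min = suc p , pp , λ { zero _ → ¬p0 ; (suc q) q<p → min q (s≤s⁻¹ q<p) }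

_≟ʷ_ : ∀ {n} (v w : Word n) → Dec (v ≡ w)
_≟ʷ_ = Vec.≡-dec _≟_

-- `init (rotate e)` is `tail e`, so each edge is followed by its rotation. Starting at the end
-- vertex of e, the first edge is `rotate e` and not e.
trail-rotations : ∀ {m} n (e : Word (suc m)) →
  Trail (tail e) (applyUpTo (λ i → rotations (suc i) e) n) (tail (rotations n e))
trail-rotations zero    e = []
trail-rotations (suc n) e = Vec.init-∷ʳ (head e) (tail e) ∷ trail-rotations n (rotate e)

-- The cycle is based at `tail e`, ready to be spliced in behind another edge with that end vertex.
-- By `from`, a set closed under rotation that meets the cycle contains e.
record PureCycle {m} (e : Word (suc m)) : Set where
  field
    cycle   : List (Word (suc m))
    trail   : Trail (tail e) cycle (tail e)
    unique  : Unique cycle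
    start   : e ∈ cycle
    to      : ∀ {e′} → e′ ∈ cycle → ∃[ i ] e′ ≡ rotations i e
    from    : ∀ {e′} → e′ ∈ cycle → ∃[ i ] e ≡ rotations i e′
    rotated : ∀ {e′} → e′ ∈ cycle → rotate e′ ∈ cycle

pureCycle : ∀ {m} (e : Word (suc m)) → PureCycle e
-- The least period is `suc p`; a full turn of `suc m` rotations shows that a period exists.
pureCycle {m} e with least (λ i → rotations (suc i) e ≟ʷ e) m (rotations-length e)
... | p , period , min = record
  { cycle   = applyUpTo f (suc p)
  ; trail   = subst (λ e′ → Trail (tail e) (applyUpTo f (suc p)) (tail e′)) period (trail-rotations (suc p) e)
  ; unique  = applyUpTo⁺₁ f (suc p) distinct
  ; start   = subst (_∈ applyUpTo f (suc p)) period (∈-applyUpTo⁺ f (n<1+n p))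
  ; to      = λ i → let k , _ , eq = ∈-applyUpTo⁻ f i in suc k , eq
  ; from    = back
  ; rotated = rot
  }
  where
  f : ℕ → Word (suc m)
  f i = rotations (suc i) e
  distinct : ∀ {i j} → i < j → j < suc p → f i ≢ f j
  distinct {i} i<j j≤p fi≡fj with m≤n⇒∃[o]m+o≡n i<j
  -- Here j is `suc i + d`. Cancelling `suc i` rotations leaves the period `suc d`, smaller than the
  -- least one.
  ... | d , ≡.refl = min d (≤-trans (s≤s (m≤n+m d i)) (s≤s⁻¹ j≤p))
    (sym (rotations-injective (suc i) (begin
      rotations (suc i) e                     ≡⟨ fi≡fj ⟩
      rotations (suc (suc i + d)) e           ≡⟨ cong (λ n → rotations (suc n) e) (+-comm (suc i) d) ⟩
      rotations (suc d + suc i) e             ≡⟨ rotations-+ (suc d) (suc i) e ⟩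
      rotations (suc i) (rotations (suc d) e) ∎)))
    where open ≡-Reasoning
  inside : ∀ k → k ≤ suc p → rotations (suc k) e ∈ applyUpTo f (suc p)
  inside k k≤ with k ≟ suc p
  ... | no  k≢     = ∈-applyUpTo⁺ f (≤∧≢⇒< k≤ k≢)
  ... | yes ≡.refl = subst (_∈ applyUpTo f (suc p)) (sym (begin
    rotations (suc (suc p)) e          ≡⟨ cong (λ n → rotations n e) (+-comm 1 (suc p)) ⟩
    rotations (suc p + 1) e            ≡⟨ rotations-+ (suc p) 1 e ⟩
    rotate (rotations (suc p) e)       ≡⟨ cong rotate period ⟩
    rotate e                           ∎)) (∈-applyUpTo⁺ f (s≤s z≤n))
    where open ≡-Reasoning
  rot : ∀ {e′} → e′ ∈ applyUpTo f (suc p) → rotate e′ ∈ applyUpTo f (suc p)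
  rot i with ∈-applyUpTo⁻ f i
  ... | k , k≤p , ≡.refl = subst (_∈ applyUpTo f (suc p))
    (≡.trans (cong (λ n → rotations n e) (+-comm 1 (suc k))) (rotations-+ (suc k) 1 e))
    (inside (suc k) k≤p)
  back : ∀ {e′} → e′ ∈ applyUpTo f (suc p) → ∃[ i ] e ≡ rotations i e′
  back i with ∈-applyUpTo⁻ f i
  ... | k , k≤p , ≡.refl with m≤n⇒∃[o]m+o≡n k≤p
  ... | d , eq = d , (begin
    e                                     ≡⟨ period ⟨
    rotations (suc p) e                   ≡⟨ cong (λ n → rotations n e) eq ⟨
    rotations (suc k + d) e               ≡⟨ rotations-+ (suc k) d e ⟩
    rotations d (rotations (suc k) e)     ∎)
    where open ≡-Reasoning

-- The field `rotated` expresses that the trail is a union of pure cycles.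
record PartialCycle {m} (E : Pred (Word (suc m)) 0ℓ) (es : List (Word (suc m))) : Set where
  field
    {vertex} : Word m
    trail    : Trail vertex es vertex
    unique   : Unique es
    sound    : ∀ {e} → e ∈ es → E e
    rotated  : ∀ {e} → e ∈ es → rotate e ∈ es

-- The state in which no further pure cycle can be joined.
Inclusive : ∀ {m} → Pred (Word (suc m)) 0ℓ → List (Word (suc m)) → Set
Inclusive E es = ∀ {e e′} → e ∈ es → E e′ → tail e ≡ tail e′ → e′ ∈ es

module _ {m : ℕ} (E : Pred (Word (suc m)) 0ℓ) (rotate-E : ∀ {e} → E e → E (rotate e)) where
  open DecMembership (_≟ʷ_ {suc m}) using (_∈?_)

  partial-pureCycle : ∀ {e} → E e → ∃[ es ] (PartialCycle E es × e ∈ es)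
  partial-pureCycle {e} c = cycle , record
    { trail   = trail
    ; unique  = unique
    ; sound   = λ i → let n , eq = to i in subst E (sym eq) (rotations-preserves {E = E} rotate-E n c)
    ; rotated = rotated
    } , start
    where open PureCycle (pureCycle e)

  join : ∀ {es e e′} → PartialCycle E es → e ∈ es → E e′ → e′ ∉ es → tail e ≡ tail e′ →
    ∃[ fs ] (PartialCycle E fs × (∀ {d} → d ∈ es → d ∈ fs) × e′ ∈ fs)
  join {es} {e} {e′} part e∈es c e′∉es eq
    with trail-insert (PartialCycle.trail part) e∈es
           (subst (λ u → Trail u (PureCycle.cycle (pureCycle e′)) u) (sym eq) (PureCycle.trail (pureCycle e′)))
  ... | fs , t , π = fs , record
    { trail   = t
    ; unique  = ↭ₛ.Unique-resp-↭ (≡.setoid _) (↭⇒↭ₛ (↭-sym π))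
                  (unique-++⁺ N.unique P.unique disjoint)
    ; sound   = λ i → [ N′.sound , P.sound ]′ (split i)
    ; rotated = λ i → [ inˡ ∘ N.rotated , inʳ ∘ P.rotated ]′ (split i)
    } , inʳ , inˡ N.start
    where
    module P = PartialCycle part
    module N = PureCycle (pureCycle e′)
    module N′ = PartialCycle (proj₁ (proj₂ (partial-pureCycle c)))
    inˡ : ∀ {d} → d ∈ N.cycle → d ∈ fs
    inˡ i = ∈-resp-↭ (↭-sym π) (∈-++⁺ˡ i)
    inʳ : ∀ {d} → d ∈ es → d ∈ fs
    inʳ i = ∈-resp-↭ (↭-sym π) (∈-++⁺ʳ N.cycle i)
    split : ∀ {d} → d ∈ fs → d ∈ N.cycle ⊎ d ∈ es
    split i = ∈-++⁻ N.cycle (∈-resp-↭ π i)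
    disjoint : ∀ {d} → d ∈ N.cycle × d ∈ es → ⊥
    -- A common edge would have e′ among its rotations, and `es` is closed under rotation.
    disjoint (i , j) with N.from i
    ... | n , e′≡ = e′∉es (subst (_∈ es) (sym e′≡) (rotations-preserves {E = _∈ es} P.rotated n j))

  -- The list carried by `grow` holds exactly the edges still outside the trail. Each join removes
  -- at least d′ from it, so the growth ends.
  inclusiveCycle : ∀ {L} → (∀ {e} → E e ⇔ e ∈ L) → ∀ {e} → E e →
    ∃[ es ] (PartialCycle E es × Inclusive E es × e ∈ es)
  inclusiveCycle {L} enum {e} c with partial-pureCycle c
  ... | es , part , e∈es = grow part (remaining es L) (<-wellFounded _)
      (λ c′ ∉es → ∈-filter⁺ (λ d → ¬? (d ∈? es)) (Equivalence.to enum c′) ∉es)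
      (λ i → let j , ∉es = ∈-filter⁻ (λ d → ¬? (d ∈? es)) {xs = L} i in Equivalence.from enum j , ∉es) e∈es
    where
    remaining : List (Word (suc m)) → List (Word (suc m)) → List (Word (suc m))
    remaining es = filter (λ d → ¬? (d ∈? es))
    grow : ∀ {es} → PartialCycle E es → ∀ L → Acc _<_ (length L) →
      (∀ {d} → E d → d ∉ es → d ∈ L) → (∀ {d} → d ∈ L → E d × d ∉ es) → e ∈ es →
      ∃[ es ] (PartialCycle E es × Inclusive E es × e ∈ es)
    grow {es} part L (acc rs) complete sound e∈es
      with Any.any? (λ d′ → Any.any? (λ d → tail d ≟ʷ tail d′) es) L
    ... | no stuck = es , part , inclusive , e∈es
      where
      inclusive : Inclusive E es
      inclusive {d} {d′} d∈es c′ eq with d′ ∈? es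
      ... | yes i = i
      ... | no ∉es = ⊥-elim (stuck (lose (complete c′ ∉es) (lose d∈es eq)))
    ... | yes any with find any
    ... | d′ , d′∈L , any′ with find any′
    ... | d , d∈es , eq with join part d∈es (proj₁ (sound d′∈L)) (proj₂ (sound d′∈L)) eq
    ... | fs , part′ , es⊆fs , d′∈fs =
      grow part′ (remaining fs L)
        (rs (filter-notAll (λ d → ¬? (d ∈? fs)) L (lose d′∈L (λ ∉fs → ∉fs d′∈fs))))
        (λ c′ ∉fs → ∈-filter⁺ (λ d → ¬? (d ∈? fs)) (complete c′ (∉fs ∘ es⊆fs)) ∉fs)
        (λ i → let j , ∉fs = ∈-filter⁻ (λ d → ¬? (d ∈? fs)) {xs = L} i in proj₁ (sound j) , ∉fs)
        (es⊆fs e∈es)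

-- From closed trails to universal cycles

suc-% : ∀ i n .{{_ : NonZero n}} → suc i % n ≡ suc (i % n) % n
suc-% i n = begin
  (1 + i) % n                 ≡⟨ %-distribˡ-+ 1 i n ⟩
  (1 % n + i % n) % n         ≡⟨ cong (λ r → (1 % n + r) % n) (m%n%n≡m%n i n) ⟨
  (1 % n + (i % n) % n) % n   ≡⟨ %-distribˡ-+ 1 (i % n) n ⟨
  (1 + i % n) % n             ∎
  where open ≡-Reasoning

lookup-init : ∀ {A : Set} {n} (xs : Vec A (suc n)) (i : Fin n) → lookup (init xs) i ≡ lookup xs (inject₁ i)
lookup-init (x Vec.∷ y Vec.∷ xs) zero    = ≡.refl
lookup-init (x Vec.∷ y Vec.∷ xs) (suc i) = lookup-init (y Vec.∷ xs) i

unique-fromList : ∀ {A : Set} {xs : List A} → Unique xs → Vec.Unique (fromList xs)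
unique-fromList ListAllPairs.[]       = VecAllPairs.[]
unique-fromList (p ListAllPairs.∷ ps) = VecAll.fromList⁺ p VecAllPairs.∷ unique-fromList ps

module _ {m : ℕ} where
  trail-first : ∀ {u v : Word m} {es} → Trail u es v → ∀ i → toℕ i ≡ 0 → init (lookup (fromList es) i) ≡ u
  trail-first (eq ∷ t) zero _ = eq

  trail-next : ∀ {u v : Word m} {es} → Trail u es v → ∀ i j → toℕ j ≡ suc (toℕ i) →
    tail (lookup (fromList es) i) ≡ init (lookup (fromList es) j)
  trail-next (_ ∷ t) zero    (suc j) eq = sym (trail-first t j (suc-injective eq))
  trail-next (_ ∷ t) (suc i) (suc j) eq = trail-next t i j (suc-injective eq)

  trail-last : ∀ {u v : Word m} {es} → Trail u es v → ∀ i → suc (toℕ i) ≡ length es →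
    tail (lookup (fromList es) i) ≡ v
  trail-last (_ ∷ [])          zero    eq = ≡.refl
  trail-last (_ ∷ t@(_ ∷ _))   (suc i) eq = trail-last t i (suc-injective eq)

  -- Consecutive edges overlap in all letters but one, so moving one edge ahead moves each letter
  -- one place to the left, until it is the first.
  lookup-walk : ∀ (e : ℕ → Word (suc m)) → (∀ i → tail (e i) ≡ init (e (suc i))) →
    ∀ i j → lookup (e i) j ≡ head (e (i + toℕ j))
  lookup-walk e step i j = go (toℕ j) i j ≡.refl
    where
    open ≡-Reasoning
    lookup-zero : ∀ (w : Word (suc m)) → lookup w zero ≡ head w
    lookup-zero (_ Vec.∷ _) = ≡.refl
    lookup-suc : ∀ (w : Word (suc m)) j → lookup w (suc j) ≡ lookup (tail w) j
    lookup-suc (_ Vec.∷ _) j = ≡.refl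
    go : ∀ t i j → toℕ j ≡ t → lookup (e i) j ≡ head (e (i + t))
    go zero    i zero    eq = ≡.trans (lookup-zero (e i)) (cong (λ n → head (e n)) (sym (+-identityʳ i)))
    go (suc t) i (suc j) eq = begin
      lookup (e i) (suc j)              ≡⟨ lookup-suc (e i) j ⟩
      lookup (tail (e i)) j             ≡⟨ cong (λ w → lookup w j) (step i) ⟩
      lookup (init (e (suc i))) j       ≡⟨ lookup-init (e (suc i)) j ⟩
      lookup (e (suc i)) (inject₁ j)    ≡⟨ go t (suc i) (inject₁ j) (≡.trans (toℕ-inject₁ j) (suc-injective eq)) ⟩
      head (e (suc i + t))              ≡⟨ cong (λ n → head (e n)) (+-suc i t) ⟨
      head (e (i + suc t))              ∎

  closedTrail⇒ucycle : ∀ {u : Word m} {es} (E : Pred (Word (suc m)) 0ℓ) → .{{_ : NonZero (length es)}} →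
    Trail u es u → Unique es → (∀ {e} → e ∈ es ⇔ E e) →
    IsUCycle E (Vec.map head (fromList es))
  closedTrail⇒ucycle {u} {es} E t unique es⇔E = record
    { size   = T , unique-fromList unique , λ c → mk⇔
        (λ i → Equivalence.to es⇔E (∈-fromList⁻ i))
        (λ c → ∈-fromList⁺ (Equivalence.from es⇔E c))
    ; occurs = λ c Ec → occurrence c Ec ,
        ≡.trans (window (occurrence c Ec)) (occurrence-correct c Ec) ,
        λ {i} eq → succ-injective _ i
          (≡.trans (occurrence-correct c Ec) (≡.trans (sym eq) (window i)))
    ; sound  = λ i → subst E (sym (window i)) (Equivalence.to es⇔E (∈-fromList⁻ (∈-lookup _ T)))
    }
    where
    open ≡-Reasoning
    N : ℕ
    N = length es
    T : Vec (Word (suc m)) N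
    T = fromList es
    edge : ℕ → Word (suc m)
    edge i = lookup T (i mod N)
    toℕ-mod : ∀ i → toℕ (i mod N) ≡ i % N
    toℕ-mod i = toℕ-fromℕ< (m%n<n i N)
    toℕ-suc-mod : ∀ i → toℕ (suc i mod N) ≡ suc (toℕ (i mod N)) % N
    toℕ-suc-mod i = ≡.trans (toℕ-mod (suc i)) (≡.trans (suc-% i N) (cong (λ r → suc r % N) (sym (toℕ-mod i))))
    step : ∀ i → tail (edge i) ≡ init (edge (suc i))
    step i with suc (toℕ (i mod N)) ≟ N
    -- Behind the last edge the indices wrap to 0; there the trail closes up at u.
    ... | yes last = ≡.trans (trail-last t (i mod N) last) (sym (trail-first t (suc i mod N)
            (≡.trans (toℕ-suc-mod i) (≡.trans (cong (_% N) last) (n%n≡0 N)))))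
    ... | no ¬last = trail-next t (i mod N) (suc i mod N)
            (≡.trans (toℕ-suc-mod i) (m<n⇒m%n≡m (≤∧≢⇒< (toℕ<n (i mod N)) ¬last)))
    -- The window at i spells the edge at `suc i`, since `subword` starts reading at subscript i +
    -- 1.
    window : ∀ i → subword (suc m) (Vec.map head T) i ≡ edge (suc (toℕ i))
    window i = begin
      tabulate (λ j → lookup (Vec.map head T) ((toℕ i + suc (toℕ j)) mod N))
        ≡⟨ Vec.tabulate-cong (λ j → begin
             lookup (Vec.map head T) ((toℕ i + suc (toℕ j)) mod N) ≡⟨ Vec.lookup-map ((toℕ i + suc (toℕ j)) mod N) head T ⟩
             head (edge (toℕ i + suc (toℕ j)))     ≡⟨ cong (λ n → head (edge n)) (+-suc (toℕ i) (toℕ j)) ⟩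
             head (edge (suc (toℕ i) + toℕ j))     ≡⟨ lookup-walk edge step (suc (toℕ i)) j ⟨
             lookup (edge (suc (toℕ i))) j         ∎) ⟩
      tabulate (lookup (edge (suc (toℕ i))))  ≡⟨ Vec.tabulate∘lookup _ ⟩
      edge (suc (toℕ i))                      ∎
    suc+pred : ∀ i → suc i + pred N ≡ i + N
    suc+pred i = ≡.trans (sym (+-suc i (pred N))) (cong (i +_) (suc-pred N))
    pred-suc : ∀ (i : Fin N) → (suc (toℕ i) % N + pred N % N) % N ≡ toℕ i
    pred-suc i = begin
      (suc (toℕ i) % N + pred N % N) % N  ≡⟨ %-distribˡ-+ (suc (toℕ i)) (pred N) N ⟨
      (suc (toℕ i) + pred N) % N          ≡⟨ cong (_% N) (suc+pred (toℕ i)) ⟩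
      (toℕ i + N) % N                     ≡⟨ [m+n]%n≡m%n (toℕ i) N ⟩
      toℕ i % N                           ≡⟨ m<n⇒m%n≡m (toℕ<n i) ⟩
      toℕ i                               ∎
    succ-injective : ∀ i j → edge (suc (toℕ i)) ≡ edge (suc (toℕ j)) → i ≡ j
    succ-injective i j eq = toℕ-injective (begin
      toℕ i                               ≡⟨ pred-suc i ⟨
      (suc (toℕ i) % N + pred N % N) % N  ≡⟨ cong (λ r → (r + pred N % N) % N) (begin
        suc (toℕ i) % N                   ≡⟨ toℕ-mod (suc (toℕ i)) ⟨
        toℕ (suc (toℕ i) mod N)           ≡⟨ cong toℕ (Vec.lookup-injective (unique-fromList unique) _ _ eq) ⟩
        toℕ (suc (toℕ j) mod N)           ≡⟨ toℕ-mod (suc (toℕ j)) ⟩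
        suc (toℕ j) % N                   ∎) ⟩
      (suc (toℕ j) % N + pred N % N) % N  ≡⟨ pred-suc j ⟩
      toℕ j                               ∎)
    index : ∀ c → E c → c Vec.∈ T
    index c Ec = ∈-fromList⁺ (Equivalence.from es⇔E Ec)
    -- The window position is one before the index of the edge; adding `pred N` subtracts one modulo
    -- N.
    occurrence : ∀ c → E c → Fin N
    occurrence c Ec = (toℕ (VecAny.index (index c Ec)) + pred N) mod N
    occurrence-correct : ∀ c Ec → edge (suc (toℕ (occurrence c Ec))) ≡ c
    occurrence-correct c Ec = ≡.trans (cong (lookup T) (toℕ-injective (begin
      toℕ (suc (toℕ (occurrence c Ec)) mod N)   ≡⟨ toℕ-mod _ ⟩
      suc (toℕ (occurrence c Ec)) % N           ≡⟨ cong (λ r → suc r % N) (toℕ-mod (toℕ p + pred N)) ⟩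
      suc ((toℕ p + pred N) % N) % N            ≡⟨ suc-% (toℕ p + pred N) N ⟨
      (suc (toℕ p) + pred N) % N                ≡⟨ cong (_% N) (suc+pred (toℕ p)) ⟩
      (toℕ p + N) % N                           ≡⟨ [m+n]%n≡m%n (toℕ p) N ⟩
      toℕ p % N                                 ≡⟨ m<n⇒m%n≡m (toℕ<n p) ⟩
      toℕ p                                     ∎)))
      (sym (VecAny.lookup-index (index c Ec)))
      where p = VecAny.index (index c Ec)

-- Universal cycles for prefixes of weak orders

isEdge-rotate : ∀ {k m} {e : Word (suc m)} → IsEdge k e → IsEdge k (rotate e)
isEdge-rotate {e = x Vec.∷ u} (y , o , ≡k) =
  y , isOrderList-↭ (prep y (toList-∷ʳ-↭ u x)) o , ≡.trans (cong (y +_) (sym (weight-∷ʳ u x))) ≡k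

-- Membership in `es`, read as a property of words with the dropped letter in front, is `Closed`;
-- connectivity then carries it from e to every edge.
inclusive⇒all : ∀ {k m es} {e e′ : Word (suc m)} (let E = IsEdge k {suc m}) →
  PartialCycle E es → Inclusive E es →
  e ∈ es → E e → E e′ → e′ ∈ es
inclusive⇒all {k} {m} {es} {e} {e′} part incl e∈es (y , o , ≡k) (y′ , o′ , ≡k′)
  with closed⇒all closed o o′ (cong suc (≡.trans (Vec.length-toList e) (sym (Vec.length-toList e′))))
         (≡.trans (cong (y +_) (sum-toList e)) (≡.trans ≡k (sym (≡.trans (cong (y′ +_) (sum-toList e′)) ≡k′))))
         (e , ≡.refl , e∈es , ≡k)
  where
  Q : Pred (List ℕ) 0ℓ
  Q []      = ⊥
  Q (y ∷ l) = Σ[ d ∈ Word (suc m) ] (toList d ≡ l × d ∈ es × y + weight d ≡ k)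
  closed : Closed Q
  closed = record
    { rotate   = λ { (x Vec.∷ u , ≡.refl , i , ≡k) →
        u ∷ʳ x , Vec.toList-∷ʳ x u , PartialCycle.rotated part i ,
        ≡.trans (cong (_ +_) (sym (weight-∷ʳ u x))) ≡k }
    -- The edges with first letters x and x′ share the end vertex u, so inclusiveness applies.
    ; exchange = λ { {y} {x} {y′} {x′} y+x≡ o (x Vec.∷ u , ≡.refl , i , ≡k) →
        let ≡k′ = ≡.trans (sym (+-assoc y′ x′ (weight u)))
                    (≡.trans (cong (_+ weight u) (sym y+x≡)) (≡.trans (+-assoc y x (weight u)) ≡k))
        in x′ Vec.∷ u , ≡.refl , incl i (y′ , o , ≡k′) ≡.refl , ≡k′ }
    }
... | d , eq , i , _ = subst (_∈ es) (toList-injective d e′ eq) i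

emptyUCycle : ∀ {m} {E : Pred (Word m) 0ℓ} → (∀ c → ¬ E c) → IsUCycle E Vec.[]
emptyUCycle ¬E = record
  { size   = Vec.[] , VecAllPairs.[] , λ c → mk⇔ (λ ()) (λ Ec → ⊥-elim (¬E c Ec))
  ; occurs = λ c Ec → ⊥-elim (¬E c Ec)
  ; sound  = λ ()
  }

theorem3p3 : ∀ (n k : ℕ) → 1 ≤ n → 1 ≤ k → k ≤ n C 2 →
    ∃[ N ] Σ[ a ∈ Word N ] IsUCycle (𝒲⁻ k n) a
-- For n = 1 the binomial coefficient is 0, below any positive k.
theorem3p3 (suc zero) (suc k) _ _ ()
theorem3p3 (suc (suc m)) k _ _ _ with edges k (suc m) in eq
... | [] = 0 , Vec.[] , emptyUCycle λ c Ec →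
  ¬Any[] (subst (c ∈_) eq (isEdge⇒∈-edges (𝒲⁻⇒isEdge Ec)))
... | e ∷ _ with ∈-edges⇒isEdge {k} (subst (e ∈_) (sym eq) (here ≡.refl))
... | Ee with inclusiveCycle (IsEdge k) isEdge-rotate (mk⇔ isEdge⇒∈-edges (∈-edges⇒isEdge {k})) Ee
-- The trail contains e; matching it as a cons makes its length visibly nonzero, as arithmetic
-- modulo the length requires.
... | es@(_ ∷ _) , part , incl , e∈es = length es , _ ,
  closedTrail⇒ucycle (𝒲⁻ k (suc (suc m))) (PartialCycle.trail part) (PartialCycle.unique part)
    (mk⇔ (λ i → isEdge⇒𝒲⁻ (PartialCycle.sound part i))
         (λ c → inclusive⇒all part incl e∈es Ee (𝒲⁻⇒isEdge c)))
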